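{- Let $F_1, F_2, \ldots, F_k$ be graphs with a common vertex set $V$ of size $n$ such that $\delta(F_i) \ge \delta \ge 1$ for every $i$, where $\delta$ is an integer. Let $G = G(F_1,\ldots,F_k)$ be the combined graph and let $\overline{d} = \overline{d}(G)$ be its average degree. Then the following hold. (a) $\gamma_{\rm sd}(F_1,F_2,\ldots,F_k) \le \tau_{\delta-1}(G) = n - \alpha_{\delta-1}(G)$. (b) $\displaystyle \gamma_{\rm sd}(F_1,F_2,\ldots,F_k) \le \left( \frac{\lceil \overline{d} \rceil}{\lceil \overline{d} \rceil + \delta} \right) n$. (c) If in addition each of $F_1, F_2, \ldots, F_k$ is regular of degree $\delta$, then $\displaystyle \gamma_{\rm sd}(F_1,F_2,\ldots,F_k) \le \left( \frac{k}{k+1} \right) n$.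
   Context: All graphs are finite and simple. Given graphs $F_1,\ldots,F_k$ (called factors; not necessarily edge-disjoint) with common vertex set $V$, the combined graph $G(F_1,\ldots,F_k)$ has vertex set $V$ and edge set $\bigcup_{i=1}^k E(F_i)$. A dominating set of a graph is a set $S$ of vertices such that every vertex outside $S$ is adjacent to some vertex in $S$. A set $S \subseteq V$ is a simultaneous dominating set (SD-set) if $S$ is a dominating set in each $F_i$, $1 \le i \le k$. The simultaneous domination number $\gamma_{\rm sd}(F_1,\ldots,F_k)$ is the minimum cardinality of an SD-set. $\delta(F_i)$ denotes the minimum degree of $F_i$, and the average degree of a graph with $n$ vertices and $m$ edges is $2m/n$. For an integer $t \ge 0$, a $t$-vertex cover in $G$ is a set $S$ of vertices such that the subgraph $G[V \setminus S]$ has maximum degree at most $t$; $\tau_t(G)$ is the minimum cardinality of a $t$-vertex cover. A $t$-independent set in $G$ is a set $S$ of vertices such that $G[S]$ has maximum degree at most $t$; $\alpha_t(G)$ is the maximum cardinality of a $t$-independent set. -}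

module Defs where

open import Data.Fin.Base using (Fin; zero; suc)
open import Data.Fin.Properties using (all?; any?; _<?_)
open import Data.Fin.Subset using (Subset; inside; outside; _∈_; _∉_; ∁; ∣_∣)
open import Data.Fin.Subset.Properties using (_∈?_)
open import Data.Integer.Base as ℤ using (+_)
open import Data.List.Base
  using (List; []; _∷_; _++_; map; filter; length; allFin; cartesianProduct)
open import Data.List.Extrema.Nat using (min; max)
open import Data.Nat.Base using (ℕ; zero; suc; _+_; _*_; _≤_; NonZero; ≢-nonZero; ≢-nonZero⁻¹)
open import Data.Nat.Properties using (_≤?_; m+n≡0⇒n≡0)
open import Data.Product.Base using (∃; _×_; _,_)
open import Data.Rational.Base using (ℚ; _/_; ceiling)
open import Data.Vec.Base using ([]; _∷_; tabulate)
open import Level using (0ℓ)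
open import Relation.Binary.Core using (Rel)
open import Relation.Binary.Definitions using (Decidable; Symmetric; Irreflexive)
open import Relation.Binary.PropositionalEquality using (_≡_; cong)
open import Relation.Nullary.Decidable using (does; ¬?; _×-dec_; _→-dec_)
open import Relation.Unary using (Pred) renaming (Decidable to Decidable₁)

private
  variable
    n k : ℕ

record Graph (n : ℕ) : Set₁ where
  field
    Adj        : Rel (Fin n) 0ℓ
    adj?       : Decidable Adj
    adj-sym    : Symmetric Adj
    adj-irrefl : Irreflexive _≡_ Adj

open Graph public

neighbours : Graph n → Fin n → Subset n
neighbours G v = tabulate λ w → does (adj? G v w)

degree : Graph n → Fin n → ℕ
degree G v = ∣ neighbours G v ∣

-- Every degree is less than n, so for n > 0 the bound n is never the minimum.
minDegree : Graph n → ℕ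
minDegree {n} G = min n (map (degree G) (allFin n))

maxDegree : Graph n → ℕ
maxDegree {n} G = max 0 (map (degree G) (allFin n))

IsRegular : Graph n → ℕ → Set
IsRegular G d = ∀ v → degree G v ≡ d

-- Each edge {u , v} is counted once, as the pair with u < v.
edgeCount : Graph n → ℕ
edgeCount {n} G =
  length (filter (λ (u , v) → (u <? v) ×-dec adj? G u v)
                 (cartesianProduct (allFin n) (allFin n)))

averageDegree : .{{NonZero n}} → Graph n → ℚ
averageDegree {n} G = + (2 * edgeCount G) / n

-- The average degree is non-negative, so taking the absolute value of its
-- integer ceiling only changes the type.
⌈averageDegree⌉ : .{{NonZero n}} → Graph n → ℕ
⌈averageDegree⌉ G = ℤ.∣ ceiling (averageDegree G) ∣

+-nonZeroʳ : ∀ m n .{{_ : NonZero n}} → NonZero (m + n)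
+-nonZeroʳ m n = ≢-nonZero λ eq → ≢-nonZero⁻¹ n (m+n≡0⇒n≡0 m eq)

combined : (Fin k → Graph n) → Graph n
combined F .Adj u v               = ∃ λ i → Adj (F i) u v
combined F .adj? u v              = any? λ i → adj? (F i) u v
combined F .adj-sym (i , p)       = i , adj-sym (F i) p
combined F .adj-irrefl eq (i , p) = adj-irrefl (F i) eq p

-- The increasing enumeration of the elements of S.
element : (S : Subset n) → Fin ∣ S ∣ → Fin n
element (inside  ∷ S) zero    = zero
element (inside  ∷ S) (suc i) = suc (element S i)
element (outside ∷ S) i       = suc (element S i)

-- G [ S ] is relabelled so that its vertex set is Fin ∣ S ∣.
infix 9 _[_]
_[_] : Graph n → (S : Subset n) → Graph ∣ S ∣
(G [ S ]) .Adj i j       = Adj G (element S i) (element S j)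
(G [ S ]) .adj? i j      = adj? G (element S i) (element S j)
(G [ S ]) .adj-sym       = adj-sym G
(G [ S ]) .adj-irrefl eq = adj-irrefl G (cong (element S) eq)

subsets : ∀ n → List (Subset n)
subsets zero    = [] ∷ []
subsets (suc n) = map (outside ∷_) (subsets n) ++ map (inside ∷_) (subsets n)

-- Cardinalities are at most n, so the bound n is harmless as soon as some
-- subset satisfies P. This is so in both uses below: the full vertex set is an
-- SD-set and a t-vertex cover.
minSize : {P : Pred (Subset n) 0ℓ} → Decidable₁ P → ℕ
minSize {n} P? = min n (map ∣_∣ (filter P? (subsets n)))

-- The bound 0 is likewise harmless below: the empty set is t-independent.
maxSize : {P : Pred (Subset n) 0ℓ} → Decidable₁ P → ℕ
maxSize {n} P? = max 0 (map ∣_∣ (filter P? (subsets n)))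

IsDominating : Graph n → Subset n → Set
IsDominating G S = ∀ v → v ∉ S → ∃ λ w → w ∈ S × Adj G v w

isDominating? : (G : Graph n) → Decidable₁ (IsDominating G)
isDominating? G S =
  all? λ v → ¬? (v ∈? S) →-dec any? λ w → (w ∈? S) ×-dec adj? G v w

IsSDSet : (Fin k → Graph n) → Subset n → Set
IsSDSet F S = ∀ i → IsDominating (F i) S

isSDSet? : (F : Fin k → Graph n) → Decidable₁ (IsSDSet F)
isSDSet? F S = all? λ i → isDominating? (F i) S

γsd : (Fin k → Graph n) → ℕ
γsd F = minSize (isSDSet? F)

IsVertexCover : ℕ → Graph n → Subset n → Set
IsVertexCover t G S = maxDegree (G [ ∁ S ]) ≤ t

isVertexCover? : ∀ t (G : Graph n) → Decidable₁ (IsVertexCover t G)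
isVertexCover? t G S = maxDegree (G [ ∁ S ]) ≤? t

τ : ℕ → Graph n → ℕ
τ t G = minSize (isVertexCover? t G)

IsIndependent : ℕ → Graph n → Subset n → Set
IsIndependent t G S = maxDegree (G [ S ]) ≤ t

isIndependent? : ∀ t (G : Graph n) → Decidable₁ (IsIndependent t G)
isIndependent? t G S = maxDegree (G [ S ]) ≤? t

α : ℕ → Graph n → ℕ
α t G = maxSize (isIndependent? t G)

{-# OPTIONS --safe #-}
-- Both (b) and (c) follow from (a) and a lower bound for α_{q-1}, q = δ. For
-- that bound, every vertex set U contains a set A inducing maximum degree less
-- than q such that each vertex of B = U ∖ A has at least q neighbours in A
-- (Favaron): minimise e(A) - (q - 1/2) ∣A∣. Then e(U) ≥ e(B) + q ∣B∣, and
-- repeating the step r times gives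
--   r (r + 1) q α_{q-1}(G) + 2 e(G) ≥ 2 r q n.
-- If 2 e(G) ≤ n d, then r = ⌊d / q⌋ + 1 yields α_{q-1}(G) (d + q) ≥ q n. Take d
-- to be the rounded average degree for (b) and d = k δ for (c).
module Submission where

open import Defs
open import Algebra.Properties.Semiring.Sum using ()
open import Data.Bool.Base using (Bool; true; false; _∧_)
open import Data.Fin.Base using (Fin; zero; suc)
open import Data.Fin.Properties using (_≟_; _<?_; <-cmp; any?)
open import Data.Fin.Subset
  using (Subset; inside; outside; _∈_; _∉_; _⊆_; ∁; ⊤; ⊥; _─_; ∣_∣)
open import Data.Fin.Subset.Properties
  using (_∈?_; ∉⊥; ⊥⊆; ∣p∣≤n; ∣⊤∣≡n; ∣∁p∣≡n∸∣p∣; x∉p⇒x∈∁p; p─q⊆p; drop-∷-⊆)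
import Data.Integer.Base as ℤ
import Data.Integer.DivMod as ℤ
import Data.Integer.GCD as ℤ using (gcd)
import Data.Integer.Properties as ℤ
open import Data.List.Base as List
  using (List; length; filter; cartesianProduct; allFin; _++_)
open import Data.List.Extrema.Nat using (min≤xs; max≤v⁺; xs≤max; argmin-sel; argmax-sel)
import Data.List.Membership.Propositional as List
open import Data.List.Membership.Propositional.Properties
  using (∈-map⁺; ∈-map⁻; ∈-filter⁺; ∈-filter⁻; ∈-++⁺ˡ; ∈-++⁺ʳ; ∈-allFin)
import Data.List.Properties as List
import Data.List.Relation.Unary.All as All
import Data.List.Relation.Unary.All.Properties as All
open import Data.List.Relation.Unary.Any using (here)
open import Data.Nat.Base
  using (ℕ; zero; suc; _+_; _*_; _∸_; _≤_; _<_; z≤n; NonZero)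
import Data.Nat.DivMod as ℕ
open import Data.Nat.Induction using (<-wellFounded)
open import Data.Nat.Properties as ℕ hiding (_≟_; _<?_; <-cmp)
open import Data.Nat.Tactic.RingSolver using (solve-∀)
open import Data.Product.Base using (∃; _×_; _,_; proj₂)
open import Data.Rational.Base as ℚ using (_/_; ↥_; ↧_; ceiling; toℚᵘ)
import Data.Rational.Properties as ℚ
open import Data.Rational.Unnormalised.Base as ℚᵘ using (mkℚᵘ; *≤*)
import Data.Rational.Unnormalised.Properties as ℚᵘ
open import Data.Sum.Base using (_⊎_; inj₁; inj₂)
open import Data.Vec.Base as Vec using ([]; _∷_; lookup; _[_]≔_)
open import Data.Vec.Properties
  using (lookup∘update; lookup∘update′; lookup∘tabulate; lookup-replicate; []=⇒lookup; lookup⇒[]=)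
open import Function.Base using (_∘_; id)
open import Induction.WellFounded using (Acc; acc)
open import Level using (0ℓ)
open import Relation.Binary.Definitions using (tri<; tri≈; tri>)
open import Relation.Binary.PropositionalEquality
  using (_≡_; _≢_; refl; sym; trans; cong; cong₂; subst; subst₂; module ≡-Reasoning)
open import Relation.Nullary.Decidable
  using (yes; no; does; dec-true; dec-false; _×-dec_; _⊎-dec_; ¬?)
open import Relation.Nullary.Negation using (¬_; contradiction)
open import Relation.Unary using (Pred) renaming (Decidable to Decidable₁)

open Algebra.Properties.Semiring.Sum +-*-semiring

private
  variable
    n k : ℕ

-- Indicator functions and sums over vertices.

indicator : Bool → ℕ
indicator true  = 1
indicator false = 0

𝟙 : Subset n → Fin n → ℕ
𝟙 S v = indicator (lookup S v)

kronecker : Fin n → Fin n → ℕ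
kronecker v w = indicator (does (v ≟ w))

adj : Graph n → Fin n → Fin n → ℕ
adj G u v = indicator (does (adj? G u v))

sum-mono : {f g : Fin n → ℕ} → (∀ v → f v ≤ g v) → sum f ≤ sum g
sum-mono {zero}  f≤g = z≤n
sum-mono {suc n} f≤g = +-mono-≤ (f≤g zero) (sum-mono (f≤g ∘ suc))

∣S∣≡∑𝟙 : (S : Subset n) → ∣ S ∣ ≡ sum (𝟙 S)
∣S∣≡∑𝟙 []            = refl
∣S∣≡∑𝟙 (inside  ∷ S) = cong suc (∣S∣≡∑𝟙 S)
∣S∣≡∑𝟙 (outside ∷ S) = ∣S∣≡∑𝟙 S

-- Moves sums over the relabelled vertex set of `G [ S ]` to `Fin n`, so that degrees in subgraphs
-- induced by different sets live on one index set.
∑-element : (S : Subset n) (f : Fin n → ℕ) →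
            sum (f ∘ element S) ≡ ∑[ v < n ] (𝟙 S v * f v)
∑-element []            f = refl
∑-element (inside  ∷ S) f = cong₂ _+_ (sym (+-identityʳ _)) (∑-element S (f ∘ suc))
∑-element (outside ∷ S) f = ∑-element S (f ∘ suc)

element-∈ : (S : Subset n) (i : Fin ∣ S ∣) → element S i ∈ S
element-∈ (inside  ∷ S) zero    = Vec.here
element-∈ (inside  ∷ S) (suc i) = Vec.there (element-∈ S i)
element-∈ (outside ∷ S) i       = Vec.there (element-∈ S i)

element-surjective : {S : Subset n} {v : Fin n} → v ∈ S → ∃ λ i → element S i ≡ v
element-surjective {S = inside  ∷ S} {zero}  _               = zero , refl
element-surjective {S = inside  ∷ S} {suc v} (Vec.there v∈S) =
  let i , eq = element-surjective v∈S in suc i , cong suc eq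
element-surjective {S = outside ∷ S} {suc v} (Vec.there v∈S) =
  let i , eq = element-surjective v∈S in i , cong suc eq

∑-kronecker-* : (v : Fin n) (f : Fin n → ℕ) → ∑[ w < n ] (kronecker v w * f w) ≡ f v
∑-kronecker-* {suc n} zero    f = begin
  f zero + 0 + sum (λ (_ : Fin n) → 0) ≡⟨ cong₂ _+_ (+-identityʳ (f zero)) (sum-replicate-zero n) ⟩
  f zero + 0                           ≡⟨ +-identityʳ (f zero) ⟩
  f zero                               ∎
  where open ≡-Reasoning
∑-kronecker-* {suc n} (suc v) f = ∑-kronecker-* v (f ∘ suc)

∑-kronecker : (v : Fin n) → sum (kronecker v) ≡ 1
∑-kronecker v = trans (sum-cong-≗ (λ w → sym (*-identityʳ (kronecker v w)))) (∑-kronecker-* v (λ _ → 1))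

-- Weighted degrees and the edge form.

adj-symmetric : (G : Graph n) (u v : Fin n) → adj G u v ≡ adj G v u
adj-symmetric G u v with adj? G u v | adj? G v u
... | yes _ | yes _ = refl
... | no _  | no _  = refl
... | yes p | no ¬p = contradiction (adj-sym G p) ¬p
... | no ¬p | yes p = contradiction (adj-sym G p) ¬p

adj-loopless : (G : Graph n) (v : Fin n) → adj G v v ≡ 0
adj-loopless G v = cong indicator (dec-false (adj? G v v) (adj-irrefl G refl))

-- For `x = 𝟙 S` this is the number of neighbours of `v` in `S`, whether or not `v` itself lies in
-- `S`.
weightedDegree : Graph n → (Fin n → ℕ) → Fin n → ℕ
weightedDegree {n} G x v = ∑[ w < n ] (x w * adj G v w)

-- For the indicators of disjoint sets this counts the edges between them, for
-- x = y the indicator of S it is twice the number of edges of G [ S ].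
edges : Graph n → (Fin n → ℕ) → (Fin n → ℕ) → ℕ
edges {n} G x y = ∑[ v < n ] (x v * weightedDegree G y v)

degree≡ : (G : Graph n) (v : Fin n) → degree G v ≡ sum (adj G v)
degree≡ G v = trans (∣S∣≡∑𝟙 (neighbours G v))
  (sum-cong-≗ λ w → cong indicator (lookup∘tabulate (λ w → does (adj? G v w)) w))

degree-induced : (G : Graph n) (S : Subset n) (i : Fin ∣ S ∣) →
                 degree (G [ S ]) i ≡ weightedDegree G (𝟙 S) (element S i)
degree-induced G S i = trans (degree≡ (G [ S ]) i) (∑-element S (adj G (element S i)))

module _ (G : Graph n) where

  -- The sum enters as a pointwise equation for `z`, because the indicator of an updated set or of a
  -- disjoint union is known to be such a sum only pointwise.
  weightedDegree-+ : (x y : Fin n → ℕ) {z : Fin n → ℕ} → (∀ v → z v ≡ x v + y v) → ∀ v →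
    weightedDegree G z v ≡ weightedDegree G x v + weightedDegree G y v
  weightedDegree-+ x y z≡x+y v = trans
    (sum-cong-≗ λ w → trans (cong (_* adj G v w) (z≡x+y w)) (*-distribʳ-+ (adj G v w) (x w) (y w)))
    (∑-distrib-+ (λ w → x w * adj G v w) (λ w → y w * adj G v w))

  edges-+ˡ : (x y : Fin n → ℕ) {z : Fin n → ℕ} → (∀ v → z v ≡ x v + y v) → ∀ u →
    edges G z u ≡ edges G x u + edges G y u
  edges-+ˡ x y z≡x+y u = trans
    (sum-cong-≗ λ v → trans (cong (_* weightedDegree G u v) (z≡x+y v))
                            (*-distribʳ-+ (weightedDegree G u v) (x v) (y v)))
    (∑-distrib-+ (λ v → x v * weightedDegree G u v) (λ v → y v * weightedDegree G u v))

  edges-+ʳ : (x y : Fin n → ℕ) {z : Fin n → ℕ} → (∀ v → z v ≡ x v + y v) → ∀ u →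
    edges G u z ≡ edges G u x + edges G u y
  edges-+ʳ x y z≡x+y u = trans
    (sum-cong-≗ λ v → trans (cong (u v *_) (weightedDegree-+ x y z≡x+y v))
                            (*-distribˡ-+ (u v) (weightedDegree G x v) (weightedDegree G y v)))
    (∑-distrib-+ (λ v → u v * weightedDegree G x v) (λ v → u v * weightedDegree G y v))

  edges-comm : ∀ x y → edges G x y ≡ edges G y x
  edges-comm x y = begin
    ∑[ v < n ] (x v * ∑[ w < n ] (y w * adj G v w))
      ≡⟨ sum-cong-≗ (λ v → *-distribˡ-sum (x v) (λ w → y w * adj G v w)) ⟩
    ∑[ v < n ] ∑[ w < n ] (x v * (y w * adj G v w))
      ≡⟨ ∑-comm (λ v w → x v * (y w * adj G v w)) ⟩
    ∑[ w < n ] ∑[ v < n ] (x v * (y w * adj G v w))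
      ≡⟨ sum-cong-≗ (λ w → sum-cong-≗ λ v →
           trans (cong (λ a → x v * (y w * a)) (adj-symmetric G v w))
                 (swap (x v) (y w) (adj G w v))) ⟩
    ∑[ w < n ] ∑[ v < n ] (y w * (x v * adj G w v))
      ≡⟨ sum-cong-≗ (λ w → *-distribˡ-sum (y w) (λ v → x v * adj G w v)) ⟨
    ∑[ w < n ] (y w * ∑[ v < n ] (x v * adj G w v)) ∎
    where
    open ≡-Reasoning
    swap : ∀ a b c → a * (b * c) ≡ b * (a * c)
    swap = solve-∀

  -- Expands a symmetric bilinear form on a sum. It serves both the change of a set by one vertex
  -- and the partition of `U` into `A` and `U ─ A`.
  edges-square : (x y : Fin n → ℕ) {z : Fin n → ℕ} → (∀ v → z v ≡ x v + y v) →
    edges G z z ≡ edges G x x + 2 * edges G y x + edges G y y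
  edges-square x y {z} z≡x+y = begin
    edges G z z
      ≡⟨ edges-+ˡ x y z≡x+y z ⟩
    edges G x z + edges G y z
      ≡⟨ cong₂ _+_ (edges-+ʳ x y z≡x+y x) (edges-+ʳ x y z≡x+y y) ⟩
    edges G x x + edges G x y + (edges G y x + edges G y y)
      ≡⟨ cong (λ e → edges G x x + e + (edges G y x + edges G y y)) (edges-comm x y) ⟩
    edges G x x + edges G y x + (edges G y x + edges G y y)
      ≡⟨ regroup (edges G x x) (edges G y x) (edges G y y) ⟩
    edges G x x + 2 * edges G y x + edges G y y ∎
    where
    open ≡-Reasoning
    regroup : ∀ a b c → a + b + (b + c) ≡ a + 2 * b + c
    regroup = solve-∀

  weightedDegree-kronecker : ∀ v → weightedDegree G (kronecker v) v ≡ 0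
  weightedDegree-kronecker v = trans (∑-kronecker-* v (adj G v)) (adj-loopless G v)

  edges-kronecker : ∀ v x → edges G (kronecker v) x ≡ weightedDegree G x v
  edges-kronecker v x = ∑-kronecker-* v (weightedDegree G x)

-- Indicators of modified sets.

𝟙-insert : (S : Subset n) (v : Fin n) → v ∉ S → ∀ w → 𝟙 (S [ v ]≔ inside) w ≡ 𝟙 S w + kronecker v w
𝟙-insert S v v∉S w with v ≟ w
... | yes refl rewrite lookup∘update v S inside with lookup S v in eq
...   | inside  = contradiction (lookup⇒[]= v S eq) v∉S
...   | outside = refl
𝟙-insert S v v∉S w | no v≢w
  rewrite lookup∘update′ (v≢w ∘ sym) S inside = sym (+-identityʳ _)

𝟙-remove : (S : Subset n) (v : Fin n) → v ∈ S → ∀ w → 𝟙 S w ≡ 𝟙 (S [ v ]≔ outside) w + kronecker v w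
𝟙-remove S v v∈S w with v ≟ w
... | yes refl rewrite lookup∘update v S outside | []=⇒lookup v∈S = refl
... | no v≢w rewrite lookup∘update′ (v≢w ∘ sym) S outside = sym (+-identityʳ _)

∈-[]≔-≢ : {S : Subset n} {v w : Fin n} {b : Bool} → w ≢ v → w ∈ S [ v ]≔ b → w ∈ S
∈-[]≔-≢ {S = S} {v} {w} {b} w≢v w∈ =
  lookup⇒[]= w S (trans (sym (lookup∘update′ w≢v S b)) ([]=⇒lookup w∈))

𝟙-─ : {A U : Subset n} → A ⊆ U → ∀ v → 𝟙 U v ≡ 𝟙 A v + 𝟙 (U ─ A) v
𝟙-─ {A = inside ∷ A}  {outside ∷ U} A⊆U zero    = contradiction (A⊆U Vec.here) λ ()
𝟙-─ {A = inside ∷ A}  {inside ∷ U}  A⊆U zero    = refl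
𝟙-─ {A = outside ∷ A} {inside ∷ U}  A⊆U zero    = refl
𝟙-─ {A = outside ∷ A} {outside ∷ U} A⊆U zero    = refl
𝟙-─ {A = inside ∷ A}  {_ ∷ U}       A⊆U (suc v) = 𝟙-─ (drop-∷-⊆ A⊆U) v
𝟙-─ {A = outside ∷ A} {_ ∷ U}       A⊆U (suc v) = 𝟙-─ (drop-∷-⊆ A⊆U) v

-- Local search for an independent set that dominates with multiplicity.

module LocalSearch (G : Graph n) (t : ℕ) where

  deg : Subset n → Fin n → ℕ
  deg S = weightedDegree G (𝟙 S)

  -- Inserting v decreases it by 2t + 1 - 2 deg S v, removing v by the opposite;
  -- as 2t + 1 is odd, exactly one of the two is a strict decrease.
  potential : Subset n → ℕ
  potential S = edges G (𝟙 S) (𝟙 S) + (2 * t + 1) * (n ∸ ∣ S ∣)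

  module _ (S T : Subset n) (v : Fin n) (T≡S+v : ∀ w → 𝟙 T w ≡ 𝟙 S w + kronecker v w) where

    -- A vertex is not its own neighbour.
    deg-insert : deg T v ≡ deg S v
    deg-insert = trans (weightedDegree-+ G (𝟙 S) (kronecker v) T≡S+v v)
      (trans (cong (deg S v +_) (weightedDegree-kronecker G v)) (+-identityʳ _))

    card-insert : ∣ T ∣ ≡ suc ∣ S ∣
    card-insert = begin
      ∣ T ∣                  ≡⟨ ∣S∣≡∑𝟙 T ⟩
      sum (𝟙 T)              ≡⟨ sum-cong-≗ T≡S+v ⟩
      ∑[ w < n ] (𝟙 S w + kronecker v w) ≡⟨ ∑-distrib-+ (𝟙 S) (kronecker v) ⟩
      sum (𝟙 S) + sum (kronecker v) ≡⟨ cong₂ _+_ (sym (∣S∣≡∑𝟙 S)) (∑-kronecker v) ⟩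
      ∣ S ∣ + 1              ≡⟨ +-comm ∣ S ∣ 1 ⟩
      suc ∣ S ∣              ∎
      where open ≡-Reasoning

    edges-insert : edges G (𝟙 T) (𝟙 T) ≡ edges G (𝟙 S) (𝟙 S) + 2 * deg S v
    edges-insert = begin
      edges G (𝟙 T) (𝟙 T)
        ≡⟨ edges-square G (𝟙 S) (kronecker v) T≡S+v ⟩
      edges G (𝟙 S) (𝟙 S) + 2 * edges G (kronecker v) (𝟙 S) + edges G (kronecker v) (kronecker v)
        ≡⟨ cong₂ (λ a b → edges G (𝟙 S) (𝟙 S) + 2 * a + b) (edges-kronecker G v (𝟙 S))
             (trans (edges-kronecker G v (kronecker v)) (weightedDegree-kronecker G v)) ⟩
      edges G (𝟙 S) (𝟙 S) + 2 * deg S v + 0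
        ≡⟨ +-identityʳ _ ⟩
      edges G (𝟙 S) (𝟙 S) + 2 * deg S v ∎
      where open ≡-Reasoning

    potential-insert : potential T + (2 * t + 1) ≡ potential S + 2 * deg S v
    potential-insert = begin
      edges G (𝟙 T) (𝟙 T) + (2 * t + 1) * (n ∸ ∣ T ∣) + (2 * t + 1)
        ≡⟨ cong (λ e → e + (2 * t + 1) * (n ∸ ∣ T ∣) + (2 * t + 1)) edges-insert ⟩
      edges G (𝟙 S) (𝟙 S) + 2 * deg S v + (2 * t + 1) * (n ∸ ∣ T ∣) + (2 * t + 1)
        ≡⟨ regroup (edges G (𝟙 S) (𝟙 S)) (deg S v) (2 * t + 1) (n ∸ ∣ T ∣) ⟩
      edges G (𝟙 S) (𝟙 S) + (2 * t + 1) * suc (n ∸ ∣ T ∣) + 2 * deg S v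
        ≡⟨ cong (λ m → edges G (𝟙 S) (𝟙 S) + (2 * t + 1) * m + 2 * deg S v) suc-co-card ⟩
      potential S + 2 * deg S v ∎
      where
      open ≡-Reasoning
      -- The truncated subtraction is exact here, as `suc ∣ S ∣` is the size of `T` and hence at
      -- most `n`.
      suc-co-card : suc (n ∸ ∣ T ∣) ≡ n ∸ ∣ S ∣
      suc-co-card rewrite card-insert =
        sym (+-∸-assoc 1 (subst (_≤ n) card-insert (∣p∣≤n T)))
      regroup : ∀ a d c m → a + 2 * d + c * m + c ≡ a + c * suc m + 2 * d
      regroup = solve-∀

  decrease-of-< : ∀ {a b d} → t < d → a + 2 * d ≡ b + (2 * t + 1) → a < b
  decrease-of-< {a} {b} {d} t<d eq = +-cancelʳ-≤ (2 * t + 1) (suc a) b (begin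
    suc a + (2 * t + 1) ≡⟨ shift a t ⟩
    a + 2 * suc t       ≤⟨ +-monoʳ-≤ a (*-monoʳ-≤ 2 t<d) ⟩
    a + 2 * d           ≡⟨ eq ⟩
    b + (2 * t + 1)     ∎)
    where
    open ≤-Reasoning
    shift : ∀ a t → suc a + (2 * t + 1) ≡ a + 2 * suc t
    shift = solve-∀

  decrease-of-≤ : ∀ {a b d} → d ≤ t → a + (2 * t + 1) ≡ b + 2 * d → a < b
  decrease-of-≤ {a} {b} {d} d≤t eq = +-cancelʳ-≤ (2 * t) (suc a) b (begin
    suc a + 2 * t   ≡⟨ shift a t ⟩
    a + (2 * t + 1) ≡⟨ eq ⟩
    b + 2 * d       ≤⟨ +-monoʳ-≤ b (*-monoʳ-≤ 2 d≤t) ⟩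
    b + 2 * t       ∎)
    where
    open ≤-Reasoning
    shift : ∀ a t → suc a + 2 * t ≡ a + (2 * t + 1)
    shift = solve-∀

  -- The two ways in which `v` can violate the conclusion of `independent-dominating`; in each of
  -- them, moving `v` across the boundary of `S` lowers the potential.
  Movable : Subset n → Subset n → Fin n → Set
  Movable U S v = (v ∈ S × t < deg S v) ⊎ (v ∈ U × v ∉ S × deg S v ≤ t)

  movable? : ∀ U S → Decidable₁ (Movable U S)
  movable? U S v =
    ((v ∈? S) ×-dec (t ℕ.<? deg S v)) ⊎-dec
    ((v ∈? U) ×-dec (¬? (v ∈? S) ×-dec (deg S v ≤? t)))

  move : ∀ {U S v} → S ⊆ U → Movable U S v → ∃ λ T → T ⊆ U × potential T < potential S
  move {U} {S} {v} S⊆U (inj₁ (v∈S , t<deg)) =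
    S [ v ]≔ outside , S′⊆U , decrease-of-< t<deg decrease
    where
    -- Removal is the insertion of `v` into the smaller set read backwards; `v` has equally many
    -- neighbours in both sets.
    eq = 𝟙-remove S v v∈S
    decrease : potential (S [ v ]≔ outside) + 2 * deg S v ≡ potential S + (2 * t + 1)
    decrease = trans (cong (λ d → potential (S [ v ]≔ outside) + 2 * d) (deg-insert (S [ v ]≔ outside) S v eq))
                     (sym (potential-insert (S [ v ]≔ outside) S v eq))
    S′⊆U : S [ v ]≔ outside ⊆ U
    S′⊆U {w} w∈ with w ≟ v
    ... | yes refl = S⊆U v∈S
    ... | no w≢v   = S⊆U (∈-[]≔-≢ w≢v w∈)
  move {U} {S} {v} S⊆U (inj₂ (v∈U , v∉S , deg≤t)) =
    S [ v ]≔ inside , S′⊆U , decrease-of-≤ deg≤t (potential-insert S (S [ v ]≔ inside) v (𝟙-insert S v v∉S))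
    where
    S′⊆U : S [ v ]≔ inside ⊆ U
    S′⊆U {w} w∈ with w ≟ v
    ... | yes refl = v∈U
    ... | no w≢v   = S⊆U (∈-[]≔-≢ w≢v w∈)

  -- Descent: every move strictly lowers the potential, a natural number, so accessibility of its
  -- value justifies the recursion.
  local-minimum : ∀ U S → S ⊆ U → Acc _<_ (potential S) →
                  ∃ λ A → A ⊆ U × (∀ v → ¬ Movable U A v)
  local-minimum U S S⊆U (acc rec) with any? (movable? U S)
  ... | no none         = S , S⊆U , λ v m → none (v , m)
  ... | yes (v , m) = let T , T⊆U , T<S = move S⊆U m in local-minimum U T T⊆U (rec T<S)

  -- A vertex violating either property would be movable, so a local minimum reached from the empty
  -- set has both.
  independent-dominating : ∀ U → ∃ λ A → A ⊆ U ×
    (∀ {v} → v ∈ A → deg A v ≤ t) × (∀ {v} → v ∈ U → v ∉ A → t < deg A v)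
  independent-dominating U =
    let A , A⊆U , none = local-minimum U ⊥ ⊥⊆ (<-wellFounded _) in
    A , A⊆U , (λ v∈A → ≮⇒≥ λ t<d → none _ (inj₁ (v∈A , t<d))) ,
    (λ v∈U v∉A → ≰⇒> λ d≤t → none _ (inj₂ (v∈U , v∉A , d≤t)))

-- Extrema over vertices and over subsets.

maxDegree≤⁺ : (G : Graph n) {t : ℕ} → (∀ v → degree G v ≤ t) → maxDegree G ≤ t
maxDegree≤⁺ {n} G deg≤t = max≤v⁺ z≤n (All.map⁺ (All.universal deg≤t (allFin n)))

degree≤maxDegree : (G : Graph n) (v : Fin n) → degree G v ≤ maxDegree G
degree≤maxDegree {n} G v =
  All.lookup (xs≤max 0 (List.map (degree G) (allFin n))) (∈-map⁺ (degree G) (∈-allFin v))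

minDegree≤degree : (G : Graph n) (v : Fin n) → minDegree G ≤ degree G v
minDegree≤degree {n} G v =
  All.lookup (min≤xs n (List.map (degree G) (allFin n))) (∈-map⁺ (degree G) (∈-allFin v))

∈-subsets : (S : Subset n) → S List.∈ subsets n
∈-subsets []            = here refl
∈-subsets (outside ∷ S) = ∈-++⁺ˡ (∈-map⁺ (outside ∷_) (∈-subsets S))
∈-subsets (inside  ∷ S) = ∈-++⁺ʳ _ (∈-map⁺ (inside ∷_) (∈-subsets S))

module _ {P : Pred (Subset n) 0ℓ} (P? : Decidable₁ P) where

  sizes : List ℕ
  sizes = List.map ∣_∣ (filter P? (subsets n))

  ∈-sizes : ∀ {S} → P S → ∣ S ∣ List.∈ sizes
  ∈-sizes {S} pS = ∈-map⁺ ∣_∣ (∈-filter⁺ P? (∈-subsets S) pS)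

  ∈-sizes⁻ : ∀ {m} → m List.∈ sizes → ∃ λ S → P S × ∣ S ∣ ≡ m
  ∈-sizes⁻ m∈ =
    let S , S∈ , m≡ = ∈-map⁻ ∣_∣ m∈ in S , proj₂ (∈-filter⁻ P? {xs = subsets n} S∈) , sym m≡

  minSize≤ : ∀ S → P S → minSize P? ≤ ∣ S ∣
  minSize≤ S pS = All.lookup (min≤xs n sizes) (∈-sizes pS)

  ≤maxSize : ∀ S → P S → ∣ S ∣ ≤ maxSize P?
  ≤maxSize S pS = All.lookup (xs≤max 0 sizes) (∈-sizes pS)

  -- The minimum is a listed size or the default `n`. In the latter case the size of the witness `S`
  -- is at most `n` and at least the minimum, so `S` attains it.
  minSize-attained : ∀ S → P S → ∃ λ T → P T × ∣ T ∣ ≡ minSize P?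
  minSize-attained S pS with argmin-sel id n sizes
  ... | inj₂ min∈ = ∈-sizes⁻ min∈
  ... | inj₁ min≡n = S , pS ,
    ≤-antisym (≤-trans (∣p∣≤n S) (≤-reflexive (sym min≡n))) (minSize≤ S pS)

  maxSize-attained : ∀ S → P S → ∃ λ T → P T × ∣ T ∣ ≡ maxSize P?
  maxSize-attained S pS with argmax-sel id 0 sizes
  ... | inj₂ max∈ = ∈-sizes⁻ max∈
  ... | inj₁ max≡0 = S , pS ,
    ≤-antisym (≤maxSize S pS) (≤-trans (≤-reflexive max≡0) z≤n)

-- Independent sets and vertex covers.

module _ (G : Graph n) {t : ℕ} {S : Subset n} where

  -- Together with `independent⁻`, replaces degrees in the relabelled `G [ S ]` by numbers of
  -- neighbours in `S` counted in `G`.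
  independent⁺ : (∀ {v} → v ∈ S → weightedDegree G (𝟙 S) v ≤ t) → IsIndependent t G S
  independent⁺ deg≤t = maxDegree≤⁺ (G [ S ]) λ i →
    ≤-trans (≤-reflexive (degree-induced G S i)) (deg≤t (element-∈ S i))

  independent⁻ : IsIndependent t G S → ∀ {v} → v ∈ S → weightedDegree G (𝟙 S) v ≤ t
  independent⁻ ind {v} v∈S with element-surjective v∈S
  ... | i , refl = ≤-trans (≤-reflexive (sym (degree-induced G S i)))
                           (≤-trans (degree≤maxDegree (G [ S ]) i) ind)

-- Otherwise both summands in `𝟙-─` would be 1, but `𝟙 U v` is at most 1.
∈-─⇒∉ : {A U : Subset n} → A ⊆ U → ∀ {v} → v ∈ U ─ A → v ∉ A
∈-─⇒∉ {A = A} {U} A⊆U {v} v∈B v∈A with lookup U v | 𝟙-─ {A = A} {U} A⊆U v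
... | inside  | eq rewrite []=⇒lookup v∈A | []=⇒lookup v∈B = contradiction eq λ ()
... | outside | eq rewrite []=⇒lookup v∈A | []=⇒lookup v∈B = contradiction eq λ ()

∁-involutive : (S : Subset n) → ∁ (∁ S) ≡ S
∁-involutive []            = refl
∁-involutive (inside  ∷ S) = cong (inside ∷_) (∁-involutive S)
∁-involutive (outside ∷ S) = cong (outside ∷_) (∁-involutive S)

module _ (G : Graph n) (t : ℕ) where

  ⊥-independent : IsIndependent t G ⊥
  ⊥-independent = independent⁺ G {S = ⊥} λ v∈⊥ → contradiction v∈⊥ ∉⊥

  -- `IsVertexCover t G S` unfolds to `IsIndependent t G (∁ S)`, so only a double complement has to
  -- be removed. In the other direction a cover proof for `S` is already an independence proof for
  -- `∁ S`.
  ∁-vertexCover : ∀ S → IsIndependent t G S → IsVertexCover t G (∁ S)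
  ∁-vertexCover S = subst (IsIndependent t G) (sym (∁-involutive S))

  -- Ensures that `n ∸ α t G` is a true difference.
  α≤n : α t G ≤ n
  α≤n =
    let S , _ , ∣S∣≡α = maxSize-attained (isIndependent? t G) ⊥ ⊥-independent in
    subst (_≤ n) ∣S∣≡α (∣p∣≤n S)

  τ≡n∸α : τ t G ≡ n ∸ α t G
  τ≡n∸α = ≤-antisym τ≤n∸α n∸α≤τ
    where
    open ≤-Reasoning
    τ≤n∸α : τ t G ≤ n ∸ α t G
    τ≤n∸α with maxSize-attained (isIndependent? t G) ⊥ ⊥-independent
    ... | S , ind , ∣S∣≡α = begin
      τ t G     ≤⟨ minSize≤ (isVertexCover? t G) (∁ S) (∁-vertexCover S ind) ⟩
      ∣ ∁ S ∣   ≡⟨ ∣∁p∣≡n∸∣p∣ S ⟩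
      n ∸ ∣ S ∣ ≡⟨ cong (n ∸_) ∣S∣≡α ⟩
      n ∸ α t G ∎
    n∸α≤τ : n ∸ α t G ≤ τ t G
    n∸α≤τ with minSize-attained (isVertexCover? t G) (∁ ⊥) (∁-vertexCover ⊥ ⊥-independent)
    ... | S , cover , ∣S∣≡τ = begin
      n ∸ α t G       ≤⟨ ∸-monoʳ-≤ n (≤maxSize (isIndependent? t G) (∁ S) cover) ⟩
      n ∸ ∣ ∁ S ∣     ≡⟨ cong (n ∸_) (∣∁p∣≡n∸∣p∣ S) ⟩
      n ∸ (n ∸ ∣ S ∣) ≡⟨ m∸[m∸n]≡n (∣p∣≤n S) ⟩
      ∣ S ∣           ≡⟨ ∣S∣≡τ ⟩
      τ t G           ∎

-- Simultaneous domination in the combined graph.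

module _ (F : Fin k → Graph n) where

  private
    G = combined F

  adj-combined : ∀ {i} v w → adj (F i) v w ≤ adj G v w
  adj-combined {i} v w with adj? (F i) v w
  ... | no _  = z≤n
  ... | yes p = ≤-reflexive (cong indicator (sym (dec-true (adj? G v w) (i , p))))

  -- A vertex outside S without neighbours in S would have all its neighbours
  -- in ∁ S.
  vertexCover⇒SDSet : ∀ {t S} → (∀ i → suc t ≤ minDegree (F i)) →
                      IsVertexCover t G S → IsSDSet F S
  vertexCover⇒SDSet {t} {S} t<δ cover i v v∉S
    with any? (λ w → (w ∈? S) ×-dec adj? (F i) v w)
  ... | yes found = found
  ... | no none   = contradiction degree≤t (<⇒≱ (≤-trans (t<δ i) (minDegree≤degree (F i) v)))
    where
    open ≤-Reasoning
    neighbour∉S : ∀ w → adj (F i) v w ≤ 𝟙 (∁ S) w * adj G v w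
    neighbour∉S w with adj? (F i) v w | adj-combined {i} v w
    ... | no _  | _    = z≤n
    ... | yes p | le
      rewrite []=⇒lookup (x∉p⇒x∈∁p {p = S} (λ w∈S → none (w , w∈S , p)))
      = ≤-trans le (≤-reflexive (sym (+-identityʳ _)))
    degree≤t : degree (F i) v ≤ t
    degree≤t = begin
      degree (F i) v               ≡⟨ degree≡ (F i) v ⟩
      sum (adj (F i) v)            ≤⟨ sum-mono neighbour∉S ⟩
      weightedDegree G (𝟙 (∁ S)) v ≤⟨ independent⁻ G {S = ∁ S} cover (x∉p⇒x∈∁p v∉S) ⟩
      t                            ∎

  γsd≤τ : ∀ {t} → (∀ i → suc t ≤ minDegree (F i)) → γsd F ≤ τ t G
  γsd≤τ {t} t<δ with minSize-attained (isVertexCover? t G) (∁ ⊥) (∁-vertexCover G t ⊥ (⊥-independent G t))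
  ... | S , cover , ∣S∣≡τ =
    ≤-trans (minSize≤ (isSDSet? F) S (vertexCover⇒SDSet {t} {S} t<δ cover)) (≤-reflexive ∣S∣≡τ)

  -- Each edge of `G` lies in at least one factor; an edge shared by several factors is counted
  -- repeatedly on the right.
  degree-combined : ∀ v → degree G v ≤ ∑[ i < k ] degree (F i) v
  degree-combined v = begin
    degree G v                             ≡⟨ degree≡ G v ⟩
    sum (adj G v)                          ≤⟨ sum-mono some ⟩
    ∑[ w < n ] ∑[ i < k ] adj (F i) v w    ≡⟨ ∑-comm (λ w i → adj (F i) v w) ⟩
    ∑[ i < k ] ∑[ w < n ] adj (F i) v w    ≡⟨ sum-cong-≗ (λ i → degree≡ (F i) v) ⟨
    ∑[ i < k ] degree (F i) v              ∎
    where
    open ≤-Reasoning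
    term≤sum : ∀ {m} (f : Fin m → ℕ) i → f i ≤ sum f
    term≤sum f zero    = m≤m+n (f zero) _
    term≤sum f (suc i) = ≤-trans (term≤sum (f ∘ suc) i) (m≤n+m _ (f zero))
    some : ∀ w → adj G v w ≤ ∑[ i < k ] adj (F i) v w
    some w with adj? G v w
    ... | no _        = z≤n
    ... | yes (i , p) = ≤-trans
      (≤-reflexive (cong indicator (sym (dec-true (adj? (F i) v w) p))))
      (term≤sum (λ i → adj (F i) v w) i)

-- The lower bound for the independence number.

sum-const : ∀ n c → ∑[ _ < n ] c ≡ n * c
sum-const zero    c = refl
sum-const (suc n) c = cong (c +_) (sum-const n c)

module _ (G : Graph n) (t : ℕ) where

  private
    q = suc t
    a = α t G

  -- Induction on `r`, for all `U` at once. The at most `a` vertices of `A` cost `2 * suc r * q`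
  -- each, the difference of consecutive coefficients `r * suc r * q`. A vertex of `B` costs
  -- `2 * r * q` by induction and pays the remaining `2 * q` with its at least `q` edges to `A`,
  -- which `edges` counts twice.
  independence-bound : ∀ r (U : Subset n) →
    2 * r * q * ∣ U ∣ ≤ r * suc r * q * a + edges G (𝟙 U) (𝟙 U)
  independence-bound zero    U = z≤n
  independence-bound (suc r) U with LocalSearch.independent-dominating G t U
  ... | A , A⊆U , A-ind , A-dom = begin
    2 * suc r * q * ∣ U ∣
      ≡⟨ cong (2 * suc r * q *_) card ⟩
    2 * suc r * q * (∣ A ∣ + ∣ B ∣)
      ≡⟨ expand r q ∣ A ∣ ∣ B ∣ ⟩
    2 * suc r * q * ∣ A ∣ + (2 * r * q * ∣ B ∣ + 2 * (∣ B ∣ * q))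
      ≤⟨ +-mono-≤ (*-monoʳ-≤ (2 * suc r * q) ∣A∣≤α)
           (+-mono-≤ (independence-bound r B) (*-monoʳ-≤ 2 many-edges)) ⟩
    2 * suc r * q * a + (r * suc r * q * a + eBB + 2 * eBA)
      -- Adding the edges inside `A` completes the expansion of the edge form of `U`.
      ≤⟨ m≤n+m _ eAA ⟩
    eAA + (2 * suc r * q * a + (r * suc r * q * a + eBB + 2 * eBA))
      ≡⟨ regroup r q a eAA eBA eBB ⟩
    suc r * suc (suc r) * q * a + (eAA + 2 * eBA + eBB)
      ≡⟨ cong (suc r * suc (suc r) * q * a +_) (edges-square G (𝟙 A) (𝟙 B) (𝟙-─ A⊆U)) ⟨
    suc r * suc (suc r) * q * a + edges G (𝟙 U) (𝟙 U) ∎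
    where
    open ≤-Reasoning
    B = U ─ A
    eAA = edges G (𝟙 A) (𝟙 A)
    eBA = edges G (𝟙 B) (𝟙 A)
    eBB = edges G (𝟙 B) (𝟙 B)
    ∣A∣≤α : ∣ A ∣ ≤ a
    ∣A∣≤α = ≤maxSize (isIndependent? t G) A (independent⁺ G {S = A} A-ind)
    card : ∣ U ∣ ≡ ∣ A ∣ + ∣ B ∣
    card = begin-equality
      ∣ U ∣                         ≡⟨ ∣S∣≡∑𝟙 U ⟩
      sum (𝟙 U)                     ≡⟨ sum-cong-≗ (𝟙-─ A⊆U) ⟩
      ∑[ v < n ] (𝟙 A v + 𝟙 B v)    ≡⟨ ∑-distrib-+ (𝟙 A) (𝟙 B) ⟩
      sum (𝟙 A) + sum (𝟙 B)         ≡⟨ cong₂ _+_ (∣S∣≡∑𝟙 A) (∣S∣≡∑𝟙 B) ⟨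
      ∣ A ∣ + ∣ B ∣                 ∎
    many-edges : ∣ B ∣ * q ≤ eBA
    many-edges = begin
      ∣ B ∣ * q                ≡⟨ cong (_* q) (∣S∣≡∑𝟙 B) ⟩
      sum (𝟙 B) * q            ≡⟨ *-distribʳ-sum q (𝟙 B) ⟩
      ∑[ v < n ] (𝟙 B v * q)   ≤⟨ sum-mono vertex ⟩
      eBA                      ∎
      where
      vertex : ∀ v → 𝟙 B v * q ≤ 𝟙 B v * weightedDegree G (𝟙 A) v
      vertex v with lookup B v in eq
      ... | outside = z≤n
      ... | inside  = *-monoʳ-≤ 1 (A-dom (p─q⊆p U A v∈B) (∈-─⇒∉ A⊆U v∈B))
        where
        v∈B : v ∈ B
        v∈B = lookup⇒[]= v B eq
    expand : ∀ r q x y → 2 * suc r * q * (x + y) ≡ 2 * suc r * q * x + (2 * r * q * y + 2 * (y * q))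
    expand = solve-∀
    regroup : ∀ r q a x y z →
      x + (2 * suc r * q * a + (r * suc r * q * a + z + 2 * y)) ≡
      suc r * suc (suc r) * q * a + (x + 2 * y + z)
    regroup = solve-∀

  edges-⊤ : edges G (𝟙 ⊤) (𝟙 ⊤) ≡ ∑[ v < n ] degree G v
  edges-⊤ = begin
    edges G (𝟙 ⊤) (𝟙 ⊤)              ≡⟨ sum-cong-≗ (λ v → 𝟙⊤* v (weightedDegree G (𝟙 ⊤) v)) ⟩
    ∑[ v < n ] weightedDegree G (𝟙 ⊤) v
      ≡⟨ sum-cong-≗ (λ v → trans (sum-cong-≗ λ w → 𝟙⊤* w (adj G v w)) (sym (degree≡ G v))) ⟩
    ∑[ v < n ] degree G v            ∎
    where
    open ≡-Reasoning
    𝟙⊤* : ∀ v m → 𝟙 ⊤ v * m ≡ m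
    𝟙⊤* v m = trans (cong (λ b → indicator b * m) (lookup-replicate v inside)) (*-identityˡ m)

  -- With r = ⌊d/q⌋ + 1, y = d mod q and z = q - y the coefficients compare by
  -- 2 r q (d + q) = d (d + q) + r (r + 1) q² + y z.
  independence-lower-bound : ∀ d → ∑[ v < n ] degree G v ≤ n * d → q * n ≤ a * (d + q)
  independence-lower-bound d few = *-cancelˡ-≤ (r * suc r * q) (+-cancelʳ-≤ (n * d * (d + q)) _ _ (begin
    r * suc r * q * (q * n) + n * d * (d + q)
      ≤⟨ m≤m+n _ (n * (y * z)) ⟩
    r * suc r * q * (q * n) + n * d * (d + q) + n * (y * z)
      ≡⟨ coefficients ⟩
    2 * r * q * n * (d + q)
      ≤⟨ *-monoˡ-≤ (d + q) bound ⟩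
    (r * suc r * q * a + n * d) * (d + q)
      ≡⟨ distrib (r * suc r * q) a (n * d) (d + q) ⟩
    r * suc r * q * (a * (d + q)) + n * d * (d + q) ∎))
    where
    open ≤-Reasoning
    r = suc (d ℕ./ q)
    y = d ℕ.% q
    z = q ∸ y
    q≡ : q ≡ y + z
    q≡ = sym (m+[n∸m]≡n (<⇒≤ (ℕ.m%n<n d q)))
    bound : 2 * r * q * n ≤ r * suc r * q * a + n * d
    bound = begin
      2 * r * q * n                              ≡⟨ cong (2 * r * q *_) (∣⊤∣≡n n) ⟨
      2 * r * q * ∣ ⊤ {n} ∣                      ≤⟨ independence-bound r ⊤ ⟩
      r * suc r * q * a + edges G (𝟙 ⊤) (𝟙 ⊤)    ≡⟨ cong (r * suc r * q * a +_) edges-⊤ ⟩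
      r * suc r * q * a + ∑[ v < n ] degree G v  ≤⟨ +-monoʳ-≤ (r * suc r * q * a) few ⟩
      r * suc r * q * a + n * d                  ∎
    distrib : ∀ x a m s → (x * a + m) * s ≡ x * (a * s) + m * s
    distrib = solve-∀
    -- With `j` the quotient, `q` and `d` become polynomials in `j`, `y` and `z`, which leaves
    -- neither division nor truncated subtraction for the ring solver.
    identity : ∀ j y z n → let q = y + z; d = y + j * q; r = suc j in
      r * suc r * q * (q * n) + n * d * (d + q) + n * (y * z) ≡ 2 * r * q * n * (d + q)
    identity = solve-∀
    coefficients :
      r * suc r * q * (q * n) + n * d * (d + q) + n * (y * z) ≡ 2 * r * q * n * (d + q)
    -- Only the displayed `q` and `d` are replaced; `r`, `y` and `z`, which are defined from them,
    -- stay fixed.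
    coefficients = trans (cong₂ (λ q d → r * suc r * q * (q * n) + n * d * (d + q) + n * (y * z)) q≡ d≡)
      (trans (identity (d ℕ./ q) y z n) (sym (cong₂ (λ q d → 2 * r * q * n * (d + q)) q≡ d≡)))
      where
      d≡ : d ≡ y + (d ℕ./ q) * (y + z)
      d≡ = trans (ℕ.m≡m%n+[m/n]*n d q) (cong (λ q′ → y + (d ℕ./ q) * q′) q≡)

-- The bound `d n / (d + δ)` with its denominator cleared, where `δ` is `suc t`, for every `d` such
-- that the degree sum is at most `n * d`.
sd-bound : ∀ {t} (F : Fin k → Graph n) → (∀ i → suc t ≤ minDegree (F i)) →
  ∀ d → ∑[ v < n ] degree (combined F) v ≤ n * d → γsd F * (d + suc t) ≤ d * n
-- Adding `q * n` to both sides lets `n ∸ a` recombine with `a`.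
sd-bound {n = n} {t = t} F t<δ d few = +-cancelʳ-≤ (q * n) _ _ (begin
  γsd F * (d + q) + q * n           ≤⟨ +-mono-≤ (*-monoˡ-≤ (d + q) γ≤n∸α) (independence-lower-bound G t d few) ⟩
  (n ∸ a) * (d + q) + a * (d + q)   ≡⟨ *-distribʳ-+ (d + q) (n ∸ a) a ⟨
  (n ∸ a + a) * (d + q)             ≡⟨ cong (_* (d + q)) (m∸n+n≡m (α≤n G t)) ⟩
  n * (d + q)                       ≡⟨ distrib n d q ⟩
  d * n + q * n                     ∎)
  where
  open ≤-Reasoning
  G = combined F
  q = suc t
  a = α t G
  γ≤n∸α : γsd F ≤ n ∸ a
  γ≤n∸α = ≤-trans (γsd≤τ F t<δ) (≤-reflexive (τ≡n∸α G t))
  distrib : ∀ n d q → n * (d + q) ≡ d * n + q * n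
  distrib = solve-∀

-- Counting edges and the handshake identity.

length-filter-tabulate : ∀ {A : Set} {P : Pred A 0ℓ} (P? : Decidable₁ P) (f : Fin n → A) →
  length (filter P? (List.tabulate f)) ≡ ∑[ i < n ] indicator (does (P? (f i)))
length-filter-tabulate {zero}  P? f = refl
length-filter-tabulate {suc n} P? f with P? (f zero)
... | yes _ = cong suc (length-filter-tabulate P? (f ∘ suc))
... | no _  = length-filter-tabulate P? (f ∘ suc)

length-filter-pairs : ∀ {m} {P : Pred (Fin m × Fin n) 0ℓ} (P? : Decidable₁ P) →
  length (filter P? (cartesianProduct (allFin m) (allFin n))) ≡
  ∑[ u < m ] ∑[ v < n ] indicator (does (P? (u , v)))
length-filter-pairs {n} {m} {P} P? = go id
  where
  open ≡-Reasoning
  -- Generalised from `allFin m` to a tabulation, since the tail of `allFin` is a tabulation of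
  -- `suc`.
  go : ∀ {l} (f : Fin l → Fin m) →
    length (filter P? (cartesianProduct (List.tabulate f) (allFin n))) ≡
    ∑[ i < l ] ∑[ v < n ] indicator (does (P? (f i , v)))
  go {zero}  f = refl
  go {suc l} f = begin
    length (filter P? (row ++ rest))
      ≡⟨ cong length (List.filter-++ P? row rest) ⟩
    length (filter P? row ++ filter P? rest)
      ≡⟨ List.length-++ (filter P? row) ⟩
    length (filter P? row) + length (filter P? rest)
      ≡⟨ cong₂ _+_
           (trans (cong (length ∘ filter P?) (List.map-tabulate id (f zero ,_)))
                  (length-filter-tabulate P? (f zero ,_)))
           (go (f ∘ suc)) ⟩
    ∑[ i < suc l ] ∑[ v < n ] indicator (does (P? (f i , v))) ∎
    where
    row  = List.map (f zero ,_) (allFin n)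
    rest = cartesianProduct (List.tabulate (f ∘ suc)) (allFin n)

-- An adjacent ordered pair is counted by exactly one of `E u v` and `E v u`, according to which
-- endpoint is smaller; both double sums equal the number of edges.
handshake : (G : Graph n) → 2 * edgeCount G ≡ ∑[ v < n ] degree G v
handshake {n} G = sym (begin
  ∑[ u < n ] degree G u
    ≡⟨ sum-cong-≗ (λ u → trans (degree≡ G u) (trans (sum-cong-≗ (split u)) (∑-distrib-+ (E u) (λ v → E v u)))) ⟩
  ∑[ u < n ] (∑[ v < n ] E u v + ∑[ v < n ] E v u)
    ≡⟨ ∑-distrib-+ (λ u → ∑[ v < n ] E u v) (λ u → ∑[ v < n ] E v u) ⟩
  e + ∑[ u < n ] ∑[ v < n ] E v u
    ≡⟨ cong (e +_) (trans (∑-comm (λ u v → E v u)) (sym (+-identityʳ e))) ⟩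
  2 * e
    ≡⟨ cong (2 *_) (length-filter-pairs (λ (u , v) → (u <? v) ×-dec adj? G u v)) ⟨
  2 * edgeCount G ∎)
  where
  open ≡-Reasoning
  E : Fin n → Fin n → ℕ
  E u v = indicator (does (u <? v) ∧ does (adj? G u v))
  e = ∑[ u < n ] ∑[ v < n ] E u v
  split : ∀ u v → adj G u v ≡ E u v + E v u
  split u v with <-cmp u v
  ... | tri< u<v _ v≮u rewrite dec-true (u <? v) u<v | dec-false (v <? u) v≮u =
    sym (+-identityʳ _)
  ... | tri> u≮v _ v<u rewrite dec-false (u <? v) u≮v | dec-true (v <? u) v<u =
    adj-symmetric G u v
  ... | tri≈ u≮u refl _ rewrite dec-false (u <? u) u≮u = adj-loopless G u

-- Opened only here: earlier it would make the sections (m +_) ambiguous.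
open import Data.Integer.Base using (+_; -[1+_])

-- Ceilings and comparison of fractions.

x≤∣x∣ : ∀ x → x ℤ.≤ + ℤ.∣ x ∣
x≤∣x∣ (+ m)    = ℤ.≤-refl
x≤∣x∣ -[1+ m ] = ℤ.-≤+

floor*↧≤↥ : ∀ p → ℚ.floor p ℤ.* ↧ p ℤ.≤ ↥ p
floor*↧≤↥ p@record{} = ℤ.[n/d]*d≤n (↥ p) (↧ p)

-- The ceiling is minus the floor of `- p`, so this is the floor inequality negated.
↥≤ceiling*↧ : ∀ p → ↥ p ℤ.≤ ceiling p ℤ.* ↧ p
↥≤ceiling*↧ p@record{} = begin
  ↥ p                              ≡⟨ ℤ.neg-involutive (↥ p) ⟨
  ℤ.- (ℤ.- ↥ p)                    ≡⟨ cong ℤ.-_ (ℚ.↥-neg p) ⟨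
  ℤ.- (↥ (ℚ.- p))                  ≤⟨ ℤ.neg-mono-≤ (floor*↧≤↥ (ℚ.- p)) ⟩
  ℤ.- (ℚ.floor (ℚ.- p) ℤ.* ↧ (ℚ.- p))
    ≡⟨ ℤ.neg-distribˡ-* (ℚ.floor (ℚ.- p)) (↧ (ℚ.- p)) ⟩
  ceiling p ℤ.* ↧ (ℚ.- p)          ≡⟨ cong (ceiling p ℤ.*_) (ℚ.↧-neg p) ⟩
  ceiling p ℤ.* ↧ p                ∎
  where open ℤ.≤-Reasoning

m≤n*∣ceiling[m/n]∣ : ∀ m n .{{_ : NonZero n}} → m ≤ n * ℤ.∣ ceiling (+ m / n) ∣
m≤n*∣ceiling[m/n]∣ m n = ℤ.drop‿+≤+ (begin
  -- The fraction is stored in lowest terms; the factor `g` restores `m` and `n`.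
  + m                                ≡⟨ ℚ.↥-/ (+ m) n ⟨
  ↥ p ℤ.* g                          ≤⟨ ℤ.*-monoʳ-≤-nonNeg g ↥p≤c*↧p ⟩
  + c ℤ.* ↧ p ℤ.* g                  ≡⟨ ℤ.*-assoc (+ c) (↧ p) g ⟩
  + c ℤ.* (↧ p ℤ.* g)                ≡⟨ cong (+ c ℤ.*_) (ℚ.↧-/ (+ m) n) ⟩
  + c ℤ.* + n                        ≡⟨ ℤ.*-comm (+ c) (+ n) ⟩
  + n ℤ.* + c                        ≡⟨ ℤ.pos-* n c ⟨
  + (n * c)                          ∎)
  where
  open ℤ.≤-Reasoning
  p = + m / n
  g = ℤ.gcd (+ m) (+ n)
  c = ℤ.∣ ceiling p ∣
  ↥p≤c*↧p : ↥ p ℤ.≤ + c ℤ.* ↧ p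
  -- Passing to the absolute value can only enlarge the ceiling, so its sign need not be determined.
  ↥p≤c*↧p = ℤ.≤-trans (↥≤ceiling*↧ p) (ℤ.*-monoʳ-≤-nonNeg (↧ p) (x≤∣x∣ (ceiling p)))

-- Unnormalised rationals keep the given numerators and denominators, so there the claim is plain
-- cross multiplication.
x/1≤a/b*y/1 : ∀ x a b y .{{_ : NonZero b}} → x * b ≤ a * y → + x / 1 ℚ.≤ (+ a / b) ℚ.* (+ y / 1)
x/1≤a/b*y/1 x a b@(suc b-1) y xb≤ay = ℚ.toℚᵘ-cancel-≤ (begin
  toℚᵘ (+ x / 1)                       ≃⟨ ℚ.toℚᵘ-fromℚᵘ (mkℚᵘ (+ x) 0) ⟩
  mkℚᵘ (+ x) 0                         ≤⟨ *≤* cross ⟩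
  mkℚᵘ (+ a) b-1 ℚᵘ.* mkℚᵘ (+ y) 0     ≃⟨ ℚᵘ.*-cong (ℚ.toℚᵘ-fromℚᵘ (mkℚᵘ (+ a) b-1)) (ℚ.toℚᵘ-fromℚᵘ (mkℚᵘ (+ y) 0)) ⟨
  toℚᵘ (+ a / b) ℚᵘ.* toℚᵘ (+ y / 1)   ≃⟨ ℚ.toℚᵘ-homo-* (+ a / b) (+ y / 1) ⟨
  toℚᵘ ((+ a / b) ℚ.* (+ y / 1))       ∎)
  where
  open ℚᵘ.≤-Reasoning
  cross : + x ℤ.* + (b * 1) ℤ.≤ + a ℤ.* + y ℤ.* + 1
  cross = subst₂ ℤ._≤_
    (trans (ℤ.pos-* x b) (cong (λ m → + x ℤ.* + m) (sym (ℕ.*-identityʳ b))))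
    (trans (ℤ.pos-* a y) (sym (ℤ.*-identityʳ (+ a ℤ.* + y))))
    (ℤ.+≤+ xb≤ay)

theorem10 :
    (n k δ : ℕ) .{{_ : NonZero n}} .{{_ : NonZero k}} .{{_ : NonZero δ}}
    (F : Fin k → Graph n) →
    (∀ i → δ ≤ minDegree (F i)) →
    let G = combined F
        c = ⌈averageDegree⌉ G
    in
    (γsd F ≤ τ (δ ∸ 1) G × τ (δ ∸ 1) G ≡ n ∸ α (δ ∸ 1) G) ×
    (+ γsd F / 1 ℚ.≤ _/_ (+ c) (c + δ) {{+-nonZeroʳ c δ}} ℚ.* (+ n / 1)) ×
    ((∀ i → IsRegular (F i) δ) → + γsd F / 1 ℚ.≤ (+ k / suc k) ℚ.* (+ n / 1))
theorem10 n k δ@(suc t) F δ≤ =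
  -- With `δ` matched as `suc t`, the index `δ ∸ 1` computes to `t`.
  (γsd≤τ F δ≤ , τ≡n∸α G t) ,
  x/1≤a/b*y/1 (γsd F) c (c + δ) n {{+-nonZeroʳ c δ}} (sd-bound F δ≤ c average) ,
  λ regular → x/1≤a/b*y/1 (γsd F) k (suc k) n
    -- For `d = k * δ` the denominator `k * δ + δ` is `suc k * δ`, and the common factor `δ`
    -- cancels.
    (*-cancelʳ-≤ _ _ δ (begin
      γsd F * suc k * δ    ≡⟨ factor (γsd F) k δ ⟩
      γsd F * (k * δ + δ)  ≤⟨ sd-bound F δ≤ (k * δ) (degree-sum regular) ⟩
      k * δ * n            ≡⟨ swap k δ n ⟩
      k * n * δ            ∎))
  where
  open ℕ.≤-Reasoning
  G = combined F
  c = ⌈averageDegree⌉ G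
  average : ∑[ v < n ] degree G v ≤ n * c
  average = ≤-trans (≤-reflexive (sym (handshake G))) (m≤n*∣ceiling[m/n]∣ (2 * edgeCount G) n)
  degree-sum : (∀ i → IsRegular (F i) δ) → ∑[ v < n ] degree G v ≤ n * (k * δ)
  degree-sum regular = begin
    ∑[ v < n ] degree G v  ≤⟨ sum-mono degree≤ ⟩
    ∑[ v < n ] (k * δ)     ≡⟨ sum-const n (k * δ) ⟩
    n * (k * δ)            ∎
    where
    degree≤ : ∀ v → degree G v ≤ k * δ
    degree≤ v = begin
      degree G v                  ≤⟨ degree-combined F v ⟩
      ∑[ i < k ] degree (F i) v   ≡⟨ sum-cong-≗ (λ i → regular i v) ⟩
      ∑[ _ < k ] δ                ≡⟨ sum-const k δ ⟩
      k * δ                       ∎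
  factor : ∀ g k d → g * suc k * d ≡ g * (k * d + d)
  factor = solve-∀
  swap : ∀ k d n → k * d * n ≡ k * n * d
  swap = solve-∀
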